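{- Let $X$ be a metrizable Priestley space. Then $X$ is not an Esakia space if and only if one of $Z_1, Z_2, Z_3$ is a forbidden configuration for $X$; that is, if and only if there exist $i\in\{1,2,3\}$, a map $e\colon Z_i\to X$ that is both a topological embedding and an order embedding, and an open neighborhood $U$ of $e(y)$ in $X$ such that $e^{ -1}({\downarrow}U)=\{x,y\}$.
   Context: For a poset $X$ and $A\subseteq X$, let ${\downarrow}A=\{x\in X\mid x\le a\text{ for some }a\in A\}$ and ${\uparrow}A=\{x\in X\mid a\le x\text{ for some }a\in A\}$; $A$ is an upset if ${\uparrow}A=A$ and a downset if ${\downarrow}A=A$. A Priestley space is a compact topological space $X$ equipped with a partial order $\le$ such that whenever $x\nleq y$ there is a clopen upset $U$ with $x\in U$ and $y\notin U$. It is metrizable if its underlying topological space is metrizable. An Esakia space is a Priestley space in which the downset of each open set is open (equivalently, the downset of each clopen set is clopen). The Priestley spaces $Z_1,Z_2,Z_3$ have the same underlying topological space: the one-point compactification of the countable discrete space $\{y\}\cup\{z_n\mid n\in\omega\}$ (with $y$ and all $z_n$ pairwise distinct), where $x$ is the added point (so $x$ is the limit of the sequence $(z_n)$ and $y$ is isolated). Their partial orders are as follows, with only the listed strict relations holding. - $Z_1$: $x<y$; $z_0>z_1>z_2>\cdots$ (i.e. $z_m<z_n$ iff $m>n$); $x<z_n$ for all $n$ (so $y$ is incomparable with every $z_n$). - $Z_2$: $x<y$ and $x<z_n$ for all $n$ (so $\{y\}\cup\{z_n\mid n\in\omega\}$ is an antichain). - $Z_3$: $x<y$ only. -}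

module Defs where

open import Data.Fin.Base using (Fin; zero; suc)
open import Data.List.Base using (List; []; _++_)
open import Data.List.Membership.Propositional using () renaming (_∈_ to _∈ˡ_)
open import Data.List.Membership.Propositional.Properties using (∈-++⁺ˡ; ∈-++⁺ʳ)
open import Data.List.Relation.Unary.Any using (Any)
open import Data.Maybe.Base using (Maybe; just; nothing)
open import Data.Nat.Base as ℕ using (ℕ)
import Data.Nat.Properties as ℕₚ
open import Data.Product.Base using (_×_; _,_; proj₁; proj₂; ∃; ∃-syntax; Σ-syntax)
open import Data.Rational.Base as ℚ using (ℚ; 0ℚ; ½; ∣_∣)
import Data.Rational.Properties as ℚₚ
open import Data.Sum.Base using (_⊎_; inj₁; inj₂; map₁)
open import Data.Unit.Polymorphic.Base using (⊤)
open import Function.Bundles using (_⇔_)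
open import Function.Definitions using (Injective)
open import Function.Metric.Structures using (IsGeneralMetric)
open import Level using (Level; _⊔_; 0ℓ) renaming (suc to lsuc)
open import Relation.Binary.Core using (Rel)
import Relation.Binary.Construct.StrictToNonStrict as ToNonStrict
open import Relation.Binary.Morphism.Structures using (IsOrderMonomorphism)
open import Relation.Binary.PropositionalEquality
  using (_≡_; refl; sym; trans; cong; cong₂; subst; resp₂; isEquivalence)
open import Relation.Binary.Structures using (IsPartialOrder; IsStrictPartialOrder)
open import Relation.Nullary.Negation.Core using (¬_)
open import Relation.Unary using (Pred; _∈_; _∉_; _⊆_; _≐_; _∩_; _∪_; ∁; ⋃; _⊢_; ｛_｝)

private
  variable
    a b c ℓ r : Level

------------------------------------------------------------------------
-- Real numbers

-- ℝ is the setoid of Cauchy sequences of rationals; two sequences name the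
-- same real when `_≃ℝ_` holds.

IsCauchy : (ℕ → ℚ) → Set
IsCauchy s = ∀ ε → 0ℚ ℚ.< ε →
  ∃[ N ] ∀ m n → N ℕ.≤ m → N ℕ.≤ n → ∣ s m ℚ.- s n ∣ ℚ.< ε

record ℝ : Set where
  constructor mkℝ
  field
    seq    : ℕ → ℚ
    cauchy : IsCauchy seq

open ℝ public

infix 4 _≤ℝ_ _<ℝ_ _≃ℝ_

_≤ℝ_ : Rel ℝ 0ℓ
p ≤ℝ q = ∀ ε → 0ℚ ℚ.< ε → ∃[ N ] ∀ n → N ℕ.≤ n → seq p n ℚ.≤ seq q n ℚ.+ ε

_<ℝ_ : Rel ℝ 0ℓ
p <ℝ q = ∃[ ε ] 0ℚ ℚ.< ε × ∃[ N ] ∀ n → N ℕ.≤ n → seq p n ℚ.+ ε ℚ.≤ seq q n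

_≃ℝ_ : Rel ℝ 0ℓ
p ≃ℝ q = p ≤ℝ q × q ≤ℝ p

half : ∀ ε → 0ℚ ℚ.< ε → ∃[ δ ] 0ℚ ℚ.< δ × δ ℚ.+ δ ≡ ε
half ε ε>0 = ½ ℚ.* ε , ½ε>0 ,
  trans (sym (ℚₚ.*-distribʳ-+ ε ½ ½)) (ℚₚ.*-identityˡ ε)
  where
  ½ε>0 : 0ℚ ℚ.< ½ ℚ.* ε
  ½ε>0 = subst (ℚ._< ½ ℚ.* ε) (ℚₚ.*-zeroʳ ½) (ℚₚ.*-monoʳ-<-pos ½ ε>0)

0ℝ : ℝ
0ℝ = mkℝ (λ _ → 0ℚ) (λ ε ε>0 → 0 , λ _ _ _ _ → ε>0)

infixl 6 _+ℝ_

_+ℝ_ : ℝ → ℝ → ℝ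
p +ℝ q = mkℝ (λ n → seq p n ℚ.+ seq q n) isCauchy
  where
  rearrange : ∀ u v w t → (u ℚ.+ v) ℚ.- (w ℚ.+ t) ≡ (u ℚ.- w) ℚ.+ (v ℚ.- t)
  rearrange u v w t =
    trans (cong (u ℚ.+ v ℚ.+_) (ℚₚ.neg-distrib-+ w t))
    (trans (ℚₚ.+-assoc u v _)
    (trans (cong (u ℚ.+_)
      (trans (sym (ℚₚ.+-assoc v (ℚ.- w) (ℚ.- t)))
      (trans (cong (ℚ._+ ℚ.- t) (ℚₚ.+-comm v (ℚ.- w)))
             (ℚₚ.+-assoc (ℚ.- w) v (ℚ.- t)))))
    (sym (ℚₚ.+-assoc u (ℚ.- w) _))))

  isCauchy : IsCauchy (λ n → seq p n ℚ.+ seq q n)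
  isCauchy ε ε>0 with half ε ε>0
  ... | δ , δ>0 , refl with cauchy p δ δ>0 | cauchy q δ δ>0
  ... | M , hp | N , hq = M ℕ.⊔ N , λ m n le le′ →
    subst (λ t → ∣ t ∣ ℚ.< δ ℚ.+ δ)
      (sym (rearrange (seq p m) (seq q m) (seq p n) (seq q n)))
      (ℚₚ.≤-<-trans (ℚₚ.∣p+q∣≤∣p∣+∣q∣ (seq p m ℚ.- seq p n) (seq q m ℚ.- seq q n))
        (ℚₚ.+-mono-<
          (hp m n (ℕₚ.≤-trans (ℕₚ.m≤m⊔n M N) le) (ℕₚ.≤-trans (ℕₚ.m≤m⊔n M N) le′))
          (hq m n (ℕₚ.≤-trans (ℕₚ.m≤n⊔m M N) le) (ℕₚ.≤-trans (ℕₚ.m≤n⊔m M N) le′))))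

-- `IsGeneralMetric _≡_ _≃ℝ_ _≤ℝ_ 0ℝ` has this fact among its components.

≤ℝ-isPartialOrder : IsPartialOrder _≃ℝ_ _≤ℝ_
≤ℝ-isPartialOrder = record
  { isPreorder = record
    { isEquivalence = record
      { refl  = λ {p} → ≤-refl {p} , ≤-refl {p}
      ; sym   = λ (h , k) → k , h
      ; trans = λ {p} {q} {s} (h , k) (h′ , k′) →
          ≤-trans {p} {q} {s} h h′ , ≤-trans {s} {q} {p} k′ k
      }
    ; reflexive = proj₁
    ; trans     = λ {p} {q} {s} → ≤-trans {p} {q} {s}
    }
  ; antisym = _,_
  }
  where
  ≤-refl : ∀ {p} → p ≤ℝ p
  ≤-refl {p} ε ε>0 = 0 , λ n _ →
    subst (ℚ._≤ seq p n ℚ.+ ε) (ℚₚ.+-identityʳ (seq p n))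
      (ℚₚ.+-monoʳ-≤ (seq p n) (ℚₚ.<⇒≤ ε>0))

  ≤-trans : ∀ {p q s} → p ≤ℝ q → q ≤ℝ s → p ≤ℝ s
  ≤-trans {p} {q} {s} h k ε ε>0 with half ε ε>0
  ... | δ , δ>0 , refl with h δ δ>0 | k δ δ>0
  ... | M , hM | N , kN = M ℕ.⊔ N , λ n le →
    ℚₚ.≤-trans (hM n (ℕₚ.≤-trans (ℕₚ.m≤m⊔n M N) le))
      (subst (seq q n ℚ.+ δ ℚ.≤_) (ℚₚ.+-assoc (seq s n) δ δ)
        (ℚₚ.+-monoˡ-≤ δ (kN n (ℕₚ.≤-trans (ℕₚ.m≤n⊔m M N) le))))

------------------------------------------------------------------------
-- Topological spaces

record Topology (X : Set a) (ℓ : Level) : Set (a ⊔ lsuc ℓ) where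
  field
    Open      : Pred (Pred X ℓ) ℓ
    Open-resp : ∀ {U V} → U ≐ V → Open U → Open V
    Open-⊤    : Open (λ _ → ⊤)
    Open-∩    : ∀ {U V} → Open U → Open V → Open (U ∩ V)
    Open-⋃    : ∀ {I : Set ℓ} (U : I → Pred X ℓ) → (∀ i → Open (U i)) → Open (⋃ I U)

  Clopen : Pred (Pred X ℓ) ℓ
  Clopen U = Open U × Open (∁ U)

open Topology public using (Open; Clopen)

IsCompact : {X : Set a} → Topology X ℓ → Set (a ⊔ lsuc ℓ)
IsCompact {ℓ = ℓ} {X = X} 𝒯 =
  ∀ {I : Set ℓ} (U : I → Pred X ℓ) → (∀ i → Open 𝒯 (U i)) → (∀ x → ∃[ i ] x ∈ U i) →
  Σ[ is ∈ List I ] ∀ x → Any (λ i → x ∈ U i) is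

Metrizable : {X : Set ℓ} → Topology X ℓ → Set (lsuc ℓ)
Metrizable {ℓ} {X} 𝒯 =
  Σ[ d ∈ (X → X → ℝ) ] IsGeneralMetric _≡_ _≃ℝ_ _≤ℝ_ 0ℝ _+ℝ_ d ×
    (∀ (U : Pred X ℓ) →
      Open 𝒯 U ⇔ (∀ x → x ∈ U → ∃[ ρ ] 0ℝ <ℝ ρ × ∀ y → d x y <ℝ ρ → y ∈ U))

-- A homeomorphism onto the image with its subspace topology.

record IsTopologicalEmbedding {X : Set a} {Y : Set b}
  (𝒮 : Topology X ℓ) (𝒯 : Topology Y ℓ) (f : X → Y) : Set (a ⊔ b ⊔ lsuc ℓ) where
  field
    injective  : Injective _≡_ _≡_ f
    continuous : ∀ {V} → Open 𝒯 V → Open 𝒮 (f ⊢ V)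
    relOpen    : ∀ {U} → Open 𝒮 U → ∃[ V ] Open 𝒯 V ×
                   (λ y → ∃[ x ] x ∈ U × f x ≡ y) ≐ V ∩ (λ y → ∃[ x ] f x ≡ y)

-- The compact subsets of a discrete space are its finite subsets, so the
-- neighbourhoods of the added point `nothing` are the cofinite sets.

onePointCompactification : (D : Set a) → Topology (Maybe D) (a ⊔ ℓ)
onePointCompactification {a} {ℓ} D = record
  { Open      = λ U → nothing ∈ U → Cofinite (just ⊢ U)
  ; Open-resp = λ (U⊆V , V⊆U) cof n∈V → mono (λ _ → U⊆V) (cof (V⊆U n∈V))
  ; Open-⊤    = λ _ → [] , λ _ → inj₁ _
  ; Open-∩    = λ cofU cofV (n∈U , n∈V) → inter (cofU n∈U) (cofV n∈V)
  ; Open-⋃    = λ U cof (i , n∈Ui) → mono (λ _ d∈Ui → i , d∈Ui) (cof i n∈Ui)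
  }
  where
  Cofinite : Pred (Pred D (a ⊔ ℓ)) (a ⊔ ℓ)
  Cofinite V = Σ[ L ∈ List D ] ∀ d → d ∈ V ⊎ d ∈ˡ L

  mono : ∀ {U V : Pred D (a ⊔ ℓ)} → (∀ d → d ∈ U → d ∈ V) → Cofinite U → Cofinite V
  mono U⊆V (L , h) = L , λ d → map₁ (U⊆V d) (h d)

  inter : ∀ {U V : Pred D (a ⊔ ℓ)} → Cofinite U → Cofinite V → Cofinite (U ∩ V)
  inter {U} {V} (L , h) (M , k) = L ++ M , λ d → go (h d) (k d)
    where
    go : ∀ {d} → d ∈ U ⊎ d ∈ˡ L → d ∈ V ⊎ d ∈ˡ M → d ∈ U ∩ V ⊎ d ∈ˡ L ++ M
    go (inj₁ d∈U) (inj₁ d∈V) = inj₁ (d∈U , d∈V)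
    go (inj₁ _)   (inj₂ d∈M) = inj₂ (∈-++⁺ʳ L d∈M)
    go (inj₂ d∈L) _          = inj₂ (∈-++⁺ˡ d∈L)

------------------------------------------------------------------------
-- Ordered spaces, Priestley spaces, Esakia spaces

record OrderedSpace (c ℓ r : Level) : Set (lsuc (c ⊔ ℓ ⊔ r)) where
  field
    Carrier        : Set c
    topology       : Topology Carrier ℓ
    _≤_            : Rel Carrier r
    isPartialOrder : IsPartialOrder _≡_ _≤_

  ↓ : Pred Carrier ℓ → Pred Carrier (c ⊔ ℓ ⊔ r)
  ↓ A x = ∃[ a ] a ∈ A × x ≤ a

  ↑ : Pred Carrier ℓ → Pred Carrier (c ⊔ ℓ ⊔ r)
  ↑ A x = ∃[ a ] a ∈ A × a ≤ x

  IsUpset : Pred Carrier ℓ → Set (c ⊔ ℓ ⊔ r)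
  IsUpset A = ↑ A ≐ A

open OrderedSpace public using (Carrier; topology)

record IsPriestley (X : OrderedSpace c ℓ r) : Set (c ⊔ lsuc ℓ ⊔ r) where
  open OrderedSpace X using (_≤_; IsUpset)
  field
    compact    : IsCompact (topology X)
    separation : ∀ x y → ¬ x ≤ y →
      ∃[ U ] Clopen (topology X) U × IsUpset U × x ∈ U × y ∉ U

record PriestleySpace (ℓ : Level) : Set (lsuc ℓ) where
  field
    orderedSpace : OrderedSpace ℓ ℓ ℓ
    isPriestley  : IsPriestley orderedSpace

open PriestleySpace public using (orderedSpace; isPriestley)

IsEsakia : PriestleySpace ℓ → Set (lsuc ℓ)
IsEsakia X = ∀ U → Open (topology (orderedSpace X)) U → Open (topology (orderedSpace X)) (↓ U)
  where open OrderedSpace (orderedSpace X) using (↓)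

------------------------------------------------------------------------
-- The spaces Z₁, Z₂, Z₃

data Isolated : Set where
  y′ : Isolated
  z′ : ℕ → Isolated

ZPoint : Set
ZPoint = Maybe Isolated

pattern 𝕩   = nothing
pattern 𝕪   = just y′
pattern 𝕫 n = just (z′ n)

infix 4 _<₁_ _<₂_ _<₃_

data _<₁_ : Rel ZPoint 0ℓ where
  x<y : 𝕩 <₁ 𝕪
  x<z : ∀ {n} → 𝕩 <₁ 𝕫 n
  z<z : ∀ {m n} → m ℕ.> n → 𝕫 m <₁ 𝕫 n

data _<₂_ : Rel ZPoint 0ℓ where
  x<y : 𝕩 <₂ 𝕪
  x<z : ∀ {n} → 𝕩 <₂ 𝕫 n

data _<₃_ : Rel ZPoint 0ℓ where
  x<y : 𝕩 <₃ 𝕪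

<₁-isStrictPartialOrder : IsStrictPartialOrder _≡_ _<₁_
<₁-isStrictPartialOrder = record
  { isEquivalence = isEquivalence
  ; irrefl        = λ { refl (z<z n<n) → ℕₚ.<-irrefl refl n<n }
  ; trans         = λ { x<z (z<z _) → x<z ; (z<z p) (z<z q) → z<z (ℕₚ.<-trans q p) }
  ; <-resp-≈      = resp₂ _<₁_
  }

<₂-isStrictPartialOrder : IsStrictPartialOrder _≡_ _<₂_
<₂-isStrictPartialOrder = record
  { isEquivalence = isEquivalence
  ; irrefl        = λ { refl () }
  ; trans         = λ { x<y () ; x<z () }
  ; <-resp-≈      = resp₂ _<₂_
  }

<₃-isStrictPartialOrder : IsStrictPartialOrder _≡_ _<₃_
<₃-isStrictPartialOrder = record
  { isEquivalence = isEquivalence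
  ; irrefl        = λ { refl () }
  ; trans         = λ { x<y () }
  ; <-resp-≈      = resp₂ _<₃_
  }

-- The index i stands for the space Z_{i+1}.

Zlt : Fin 3 → Rel ZPoint 0ℓ
Zlt zero             = _<₁_
Zlt (suc zero)       = _<₂_
Zlt (suc (suc zero)) = _<₃_

Zlt-isStrictPartialOrder : ∀ i → IsStrictPartialOrder _≡_ (Zlt i)
Zlt-isStrictPartialOrder zero             = <₁-isStrictPartialOrder
Zlt-isStrictPartialOrder (suc zero)       = <₂-isStrictPartialOrder
Zlt-isStrictPartialOrder (suc (suc zero)) = <₃-isStrictPartialOrder

Z : Fin 3 → OrderedSpace 0ℓ ℓ 0ℓ
Z {ℓ} i = record
  { Carrier        = ZPoint
  ; topology       = onePointCompactification {ℓ = ℓ} Isolated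
  ; _≤_            = ToNonStrict._≤_ _≡_ (Zlt i)
  ; isPartialOrder = ToNonStrict.isPartialOrder _≡_ (Zlt i) (Zlt-isStrictPartialOrder i)
  }

IsForbiddenConfiguration : Fin 3 → PriestleySpace ℓ → Set (lsuc ℓ)
IsForbiddenConfiguration {ℓ} i X =
  Σ[ e ∈ (ZPoint → Carrier X₀) ]
    IsTopologicalEmbedding (topology (Z {ℓ} i)) (topology X₀) e ×
    IsOrderMonomorphism _≡_ _≡_ (OrderedSpace._≤_ (Z {ℓ} i)) (OrderedSpace._≤_ X₀) e ×
    ∃[ U ] Open (topology X₀) U × e 𝕪 ∈ U ×
      (e ⊢ OrderedSpace.↓ X₀ U) ≐ ｛ 𝕩 ｝ ∪ ｛ 𝕪 ｝
  where X₀ = orderedSpace X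

{-# OPTIONS --safe #-}
module Submission where

-- If ↓U is not open for an open U, metrizability yields a point x ≤ y ∈ U and
-- a sequence outside ↓U converging to x.  Since y ≰ x and no term is below x,
-- Priestley separation lets us pass to a subsequence with y ≰ z_n and with
-- z_m ≰ z_n for m < n.  A further subsequence is decreasing (then x lies below
-- it, giving Z₁) or an antichain, either above x (Z₂) or incomparable to x (Z₃).
-- Conversely, if ↓U were open, its preimage in Z_i would be an open neighbourhood
-- of x, hence cofinite, and could not be {x, y}.

open import Axiom.DoubleNegationElimination using (em⇒dne)
open import Axiom.ExcludedMiddle using (ExcludedMiddle)
open import Data.Empty using (⊥-elim)
open import Data.Fin.Base as Fin using (Fin)
open import Data.Integer.Base as ℤ using (+_; +[1+_]; +0; -[1+_])
open import Data.List.Base using (List; []; _∷_; map; upTo)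
open import Data.List.Membership.Propositional using () renaming (_∈_ to _∈ˡ_)
open import Data.List.Membership.Propositional.Properties using (∈-map⁺; ∈-upTo⁺; finite)
open import Data.List.Relation.Unary.Any using (here; there)
open import Data.Maybe.Base using (Maybe; just; nothing)
open import Data.Nat.Base as ℕ using (ℕ; zero; s≤s)
open import Data.Nat.Coprimality using (1-coprimeTo)
import Data.Nat.Properties as ℕₚ
open import Data.Product.Base using (_×_; _,_; proj₁; proj₂; ∃; ∃-syntax)
open import Data.Rational.Base as ℚ using (ℚ; mkℚ; 0ℚ; ∣_∣; *≤*; *<*)
import Data.Rational.Properties as ℚₚ
open import Data.Sum.Base using (_⊎_; inj₁; inj₂; fromInj₂)
open import Function.Base using (_∘_)
open import Function.Bundles using (_⇔_; mk⇔; mk↣; Equivalence)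
open import Function.Definitions using (Injective)
open import Level using (Level; Lift; lift; lower; suc)
open import Relation.Binary.Core using (Rel)
open import Relation.Binary.Definitions using (Transitive; tri<; tri≈; tri>)
open import Relation.Binary.PropositionalEquality using (_≡_; refl; sym; cong; subst)
open import Relation.Binary.Structures using (IsPartialOrder)
open import Relation.Nullary.Decidable using (Dec; yes; no; map′)
open import Relation.Nullary.Negation.Core using (¬_)
open import Relation.Unary using (Pred; _∈_; _∉_; _⊆_; _∩_; _∪_; ∁; _⊢_; ｛_｝)
open import Defs

private
  variable
    a b ℓ : Level

-- Only the choice of a witness `U` against `IsEsakia` ranges over predicates and uses level
-- `suc ℓ`; the rest is classical at level `ℓ`.
lower-em : ExcludedMiddle (suc ℓ) → ExcludedMiddle ℓ
lower-em {ℓ} em {P} = map′ lower lift (em {Lift (suc ℓ) P})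

-- Extraction of subsequences

Frequently Eventually : Pred ℕ a → Set a
Frequently P = ∀ N → ∃[ n ] N ℕ.≤ n × P n
Eventually P = ∃[ N ] ∀ n → N ℕ.≤ n → P n

¬frequently⇒eventually : ExcludedMiddle a → {P : Pred ℕ a} →
  ¬ Frequently P → Eventually (∁ P)
¬frequently⇒eventually em {P} ¬freq = em⇒dne em λ ¬ev →
  ¬freq λ N → em⇒dne em λ ¬n → ¬ev (N , λ n N≤n Pn → ¬n (n , N≤n , Pn))

eventually⇒frequently : {P : Pred ℕ a} → Eventually P → Frequently P
eventually⇒frequently (M , h) N = M ℕ.⊔ N , ℕₚ.m≤n⊔m M N , h _ (ℕₚ.m≤m⊔n M N)

eventually-∩ : {P : Pred ℕ a} {Q : Pred ℕ b} →
  Eventually P → Eventually Q → Eventually (P ∩ Q)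
eventually-∩ (M , h) (N , k) = M ℕ.⊔ N , λ n le →
  h n (ℕₚ.≤-trans (ℕₚ.m≤m⊔n M N) le) , k n (ℕₚ.≤-trans (ℕₚ.m≤n⊔m M N) le)

-- Iterate `next` from `u₀`; transitivity extends the relation from consecutive terms to all pairs.
chain : {A : Set a} {T : Rel A b} → Transitive T → (∀ u → ∃ (T u)) → A →
  ∃[ s ] ∀ {i j} → i ℕ.< j → T (s i) (s j)
chain {A = A} {T} T-trans next u₀ = s , λ i<j → increasing (ℕₚ.≤⇒≤′ i<j)
  where
  s : ℕ → A
  s zero      = u₀
  s (ℕ.suc i) = proj₁ (next (s i))

  increasing : ∀ {i j} → i ℕ.<′ j → T (s i) (s j)
  increasing {i} ℕ.≤′-refl           = proj₂ (next (s i))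
  increasing (ℕ.≤′-step {n = j} i<j) = T-trans (increasing i<j) (proj₂ (next (s j)))

eventually-∀≤ : {R : Rel ℕ a} → (∀ n → Eventually (R n)) →
  ∀ n → Eventually (λ m → ∀ k → k ℕ.≤ n → R k m)
eventually-∀≤ ev zero with ev zero
... | N , h = N , λ { m N≤m zero _ → h m N≤m }
eventually-∀≤ {R = R} ev (ℕ.suc n) with eventually-∩ (eventually-∀≤ ev n) (ev (ℕ.suc n))
... | N , h = N , λ m N≤m k k≤1+n → last (h m N≤m) (ℕₚ.m≤n⇒m<n∨m≡n k≤1+n)
  where
  last : ∀ {k m} → (∀ k → k ℕ.≤ n → R k m) × R (ℕ.suc n) m → k ℕ.< ℕ.suc n ⊎ k ≡ ℕ.suc n → R k m
  last (h , _) (inj₁ (s≤s k≤n)) = h _ k≤n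
  last (_ , r) (inj₂ refl)      = r

extract : {P : Pred ℕ a} {R : Rel ℕ b} → Frequently P → (∀ n → Eventually (R n)) →
  ∃[ s ] (∀ i → P (s i)) × (∀ {i j} → i ℕ.< j → s i ℕ.< s j × R (s i) (s j))
extract {P = P} {R} freq ev with chain (λ {u v w} → T-trans {u} {v} {w}) next (_ , proj₂ (proj₂ (freq 0)))
  where
  -- Demanding `R k m` for every `k ≤ n`, not just for `n`, makes `T` transitive although `R` need
  -- not be.
  T : Rel (∃ P) _
  T (n , _) (m , _) = n ℕ.< m × ∀ k → k ℕ.≤ n → R k m

  T-trans : Transitive T
  T-trans (n<m , _) (m<l , h) =
    ℕₚ.<-trans n<m m<l , λ k k≤n → h k (ℕₚ.≤-trans k≤n (ℕₚ.<⇒≤ n<m))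

  next : ∀ u → ∃ (T u)
  next (n , _) with eventually-∀≤ ev n
  ... | N , h with freq (ℕ.suc n ℕ.⊔ N)
  ... | m , le , Pm =
    (m , Pm) , ℕₚ.m⊔n≤o⇒m≤o (ℕ.suc n) N le , h m (ℕₚ.m⊔n≤o⇒n≤o (ℕ.suc n) N le)
... | s , h = proj₁ ∘ s , proj₂ ∘ s , λ i<j →
  proj₁ (h i<j) , proj₂ (h i<j) _ ℕₚ.≤-refl

StrictlyIncreasing : (ℕ → ℕ) → Set
StrictlyIncreasing s = ∀ {i j} → i ℕ.< j → s i ℕ.< s j

i≤s[i] : ∀ {s} → StrictlyIncreasing s → ∀ i → i ℕ.≤ s i
i≤s[i] s↑ zero      = ℕ.z≤n
i≤s[i] s↑ (ℕ.suc i) = ℕₚ.≤-<-trans (i≤s[i] s↑ i) (s↑ ℕₚ.≤-refl)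

-- Small positive radii

1/suc : ℕ → ℚ
1/suc n = mkℚ (+ 1) n (1-coprimeTo (ℕ.suc n))

1/suc>0 : ∀ n → 0ℚ ℚ.< 1/suc n
1/suc>0 n = *<* (ℤ.+<+ (s≤s ℕ.z≤n))

eventually-1/suc≤ : ∀ ε → 0ℚ ℚ.< ε → Eventually (λ n → 1/suc n ℚ.≤ ε)
-- Here ε is (k+1)/(d+1), so the claim reads d+1 ≤ (k+1)(n+1), and `d` serves as threshold.
eventually-1/suc≤ (mkℚ +[1+ k ] d _) _ = d , λ n d≤n → *≤* (ℤ.+≤+
  (subst (ℕ._≤ ℕ.suc k ℕ.* ℕ.suc n) (sym (ℕₚ.*-identityˡ (ℕ.suc d)))
    (ℕₚ.≤-trans (s≤s d≤n) (ℕₚ.m≤m+n (ℕ.suc n) (k ℕ.* ℕ.suc n)))))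
eventually-1/suc≤ (mkℚ +0 d _)       (*<* (ℤ.+<+ ()))
eventually-1/suc≤ (mkℚ -[1+ k ] d _) (*<* ())

constℝ : ℚ → ℝ
constℝ r = mkℝ (λ _ → r) λ ε ε>0 → 0 , λ _ _ _ _ →
  subst (λ t → ∣ t ∣ ℚ.< ε) (sym (ℚₚ.+-inverseʳ r)) ε>0

constℝ-positive : ∀ {r} → 0ℚ ℚ.< r → 0ℝ <ℝ constℝ r
constℝ-positive {r} r>0 = r , r>0 , 0 , λ _ _ → ℚₚ.≤-reflexive (ℚₚ.+-identityˡ r)

-- A positive `ρ` eventually stays above a rational ε, and 1/(n+1) drops below ε. The threshold does
-- not depend on `p`, since the distance it is applied to changes with `n`.
eventually-<1/suc⇒< : ∀ ρ → 0ℝ <ℝ ρ →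
  Eventually (λ n → ∀ p → p <ℝ constℝ (1/suc n) → p <ℝ ρ)
eventually-<1/suc⇒< ρ (ε , ε>0 , K , ε≤ρ) = proj₁ small ,
  λ n N≤n p (δ , δ>0 , M , h) → δ , δ>0 , M ℕ.⊔ K , λ k le →
    ℚₚ.≤-trans (h k (ℕₚ.m⊔n≤o⇒m≤o M K le))
    (ℚₚ.≤-trans (proj₂ small n N≤n)
      (subst (ℚ._≤ seq ρ k) (ℚₚ.+-identityˡ ε) (ε≤ρ k (ℕₚ.m⊔n≤o⇒n≤o M K le))))
  where
  small : Eventually (λ n → 1/suc n ℚ.≤ ε)
  small = eventually-1/suc≤ ε ε>0

-- Sequences and embeddings in topological spaces

module _ {X : Set ℓ} (𝒯 : Topology X ℓ) where

  Converges : (ℕ → X) → X → Set (suc ℓ)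
  Converges z x = ∀ W → Open 𝒯 W → x ∈ W → Eventually (λ n → z n ∈ W)

  Hausdorff : Set (suc ℓ)
  Hausdorff = ∀ {p q} → ¬ p ≡ q →
    ∃[ C ] ∃[ D ] Open 𝒯 C × Open 𝒯 D × p ∈ C × q ∈ D × (∀ {t} → t ∈ C → t ∉ D)

  open-local : ∀ {V} → (∀ p → p ∈ V → ∃[ W ] Open 𝒯 W × p ∈ W × W ⊆ V) → Open 𝒯 V
  open-local {V} nbhd = Topology.Open-resp 𝒯
    ((λ ((p , p∈V) , t∈W) → proj₂ (proj₂ (proj₂ (nbhd p p∈V))) t∈W) ,
     λ {p} p∈V → (p , p∈V) , proj₁ (proj₂ (proj₂ (nbhd p p∈V))))
    (Topology.Open-⋃ 𝒯 {I = ∃ V} (λ (p , p∈V) → proj₁ (nbhd p p∈V))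
      λ (p , p∈V) → proj₁ (proj₂ (nbhd p p∈V)))

  -- The balls of radius 1/(n+1) at x form a neighbourhood base; they are never
  -- shown to be open.
  ¬open⇒sequence : ExcludedMiddle ℓ → Metrizable 𝒯 → ∀ S → ¬ Open 𝒯 S →
    ∃[ x ] x ∈ S × ∃[ z ] Converges z x × ∀ n → z n ∉ S
  ¬open⇒sequence em (d , _ , metric) S ¬openS
    with em⇒dne em {∃[ x ] x ∈ S × ¬ (∃[ ρ ] 0ℝ <ℝ ρ × ∀ y → d x y <ℝ ρ → y ∈ S)}
           (λ none → ¬openS (Equivalence.from (metric S)
             λ x x∈S → em⇒dne em λ noBall → none (x , x∈S , noBall)))
  ... | x , x∈S , noBall = x , x∈S , proj₁ ∘ near , converges , proj₂ ∘ proj₂ ∘ near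
    where
    near : ∀ n → ∃[ y ] d x y <ℝ constℝ (1/suc n) × y ∉ S
    near n = em⇒dne em λ none → noBall (constℝ (1/suc n) , constℝ-positive (1/suc>0 n) ,
      λ y dxy< → em⇒dne em λ y∉S → none (y , dxy< , y∉S))

    converges : Converges (proj₁ ∘ near) x
    converges W openW x∈W =
      let ρ , ρ>0 , ball⊆W = Equivalence.to (metric W) openW x x∈W
          N , h            = eventually-<1/suc⇒< ρ ρ>0
      in N , λ n N≤n → ball⊆W _ (h n N≤n (d x _) (proj₁ (proj₂ (near n))))

  -- The classical fact that a continuous injection of a compact space into a
  -- Hausdorff space is an embedding: the complement of e(Uᶜ) is open.
  onePoint-embedding : ExcludedMiddle ℓ → Hausdorff → {D : Set} {e : Maybe D → X} →
    Injective _≡_ _≡_ e →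
    (∀ {V} → Open 𝒯 V → Open (onePointCompactification {ℓ = ℓ} D) (e ⊢ V)) →
    IsTopologicalEmbedding (onePointCompactification {ℓ = ℓ} D) 𝒯 e
  onePoint-embedding em hausdorff {D} {e} inj cont = record
    { injective  = inj
    ; continuous = cont
    ; relOpen    = λ {U} openU → V U , open-local (nbhd U openU) ,
        (λ { (q , q∈U , refl) → (λ r r∉U eq≡er → r∉U (subst U (inj eq≡er) q∈U)) , q , refl }) ,
        λ { (eq∈V , q , refl) → q , em⇒dne em (λ q∉U → eq∈V q q∉U refl) , refl }
    }
    where
    V : Pred (Maybe D) ℓ → Pred X ℓ
    V U p = ∀ q → q ∉ U → ¬ p ≡ e q

    -- Intersect finitely many Hausdorff neighbourhoods, one for each listed point outside `U`.
    avoid : ∀ U {p} → p ∈ V U → (L : List (Maybe D)) →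
      ∃[ W ] Open 𝒯 W × p ∈ W × ∀ q → q ∉ U → q ∈ˡ L → e q ∉ W
    avoid U p∈V [] = _ , Topology.Open-⊤ 𝒯 , _ , λ _ _ ()
    avoid U p∈V (q ∷ L) with avoid U p∈V L | em {q ∈ U}
    ... | W , openW , p∈W , h | yes q∈U =
      W , openW , p∈W , λ { _ q∉U (here refl) → ⊥-elim (q∉U q∈U)
                          ; r r∉U (there r∈L) → h r r∉U r∈L }
    ... | W , openW , p∈W , h | no q∉U with hausdorff (p∈V q q∉U)
    ... | C , _ , openC , _ , p∈C , q∈D , disjoint =
      C ∩ W , Topology.Open-∩ 𝒯 openC openW , (p∈C , p∈W) ,
        λ { _ _   (here refl) (q∈C , _) → disjoint q∈C q∈D
          ; r r∉U (there r∈L) (_ , r∈W) → h r r∉U r∈L r∈W }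

    -- This is where compactness enters. If `p` is the image of the added point, then `U` contains
    -- that point and its complement is already finite. Otherwise separate `p` from that image: by
    -- continuity only finitely many points map outside `E`, hence only finitely many into `C`.
    almost : ∀ U → Open (onePointCompactification {ℓ = ℓ} D) U → ∀ {p} → p ∈ V U →
      ∃[ W ] Open 𝒯 W × p ∈ W × ∃[ L ] ∀ q → q ∉ U → e q ∈ W → q ∈ˡ L
    almost U openU {p} p∈V with em {p ≡ e nothing}
    ... | yes refl = _ , Topology.Open-⊤ 𝒯 , _ , map just (proj₁ cof) , λ where
        nothing  ∞∉U _ → ⊥-elim (∞∉U ∞∈U)
        (just d) d∉U _ → ∈-map⁺ just (fromInj₂ (⊥-elim ∘ d∉U) (proj₂ cof d))
      where
      ∞∈U : nothing ∈ U
      ∞∈U = em⇒dne em λ ∞∉U → p∈V nothing ∞∉U refl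
      cof = openU ∞∈U
    ... | no p≢∞ with hausdorff p≢∞
    ... | C , E , openC , openE , p∈C , ∞∈E , disjoint with cont openE ∞∈E
    ... | L , h = C , openC , p∈C , map just L , λ where
        nothing  _ ∞∈C → ⊥-elim (disjoint ∞∈C ∞∈E)
        (just d) _ d∈C → ∈-map⁺ just (fromInj₂ (⊥-elim ∘ disjoint d∈C) (h d))

    nbhd : ∀ U → Open (onePointCompactification {ℓ = ℓ} D) U → ∀ p → p ∈ V U →
      ∃[ W ] Open 𝒯 W × p ∈ W × W ⊆ V U
    nbhd U openU p p∈V with almost U openU p∈V
    ... | W , openW , p∈W , L , h with avoid U p∈V L
    ... | W′ , openW′ , p∈W′ , h′ =
      W ∩ W′ , Topology.Open-∩ 𝒯 openW openW′ , (p∈W , p∈W′) ,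
        λ { (t∈W , t∈W′) q q∉U refl → h′ q q∉U (h q q∉U t∈W) t∈W′ }

-- The three orders treated uniformly

Zlt-x<y : ∀ i → Zlt i 𝕩 𝕪
Zlt-x<y Fin.zero                     = x<y
Zlt-x<y (Fin.suc Fin.zero)           = x<y
Zlt-x<y (Fin.suc (Fin.suc Fin.zero)) = x<y

Zlt-cases : ∀ i {p q} → Zlt i p q →
  (p , q) ≡ (𝕩 , 𝕪) ⊎ (∃[ n ] (p , q) ≡ (𝕩 , 𝕫 n)) ⊎ (∃[ m ] ∃[ n ] (p , q) ≡ (𝕫 m , 𝕫 n))
Zlt-cases Fin.zero                     x<y     = inj₁ refl
Zlt-cases Fin.zero                     x<z     = inj₂ (inj₁ (_ , refl))
Zlt-cases Fin.zero                     (z<z _) = inj₂ (inj₂ (_ , _ , refl))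
Zlt-cases (Fin.suc Fin.zero)           x<y     = inj₁ refl
Zlt-cases (Fin.suc Fin.zero)           x<z     = inj₂ (inj₁ (_ , refl))
Zlt-cases (Fin.suc (Fin.suc Fin.zero)) x<y     = inj₁ refl

-- Consequences of Priestley separation

module _ (em : ExcludedMiddle ℓ) (X : PriestleySpace ℓ) where

  private
    X₀ = orderedSpace X
    𝒯  = topology X₀
  open OrderedSpace X₀ using (_≤_; ↓)
  open IsPartialOrder (OrderedSpace.isPartialOrder X₀)
    using (antisym; reflexive) renaming (refl to ≤-refl; trans to ≤-trans)
  open IsPriestley (isPriestley X) using (separation)

  -- By antisymmetry one of the two inequalities fails; the separating clopen upset and its
  -- complement are the neighbourhoods.
  hausdorff : Hausdorff 𝒯
  hausdorff {p} {q} p≢q with em {p ≤ q} | em {q ≤ p}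
  ... | yes p≤q | yes q≤p = ⊥-elim (p≢q (antisym p≤q q≤p))
  ... | no p≰q  | _ with separation p q p≰q
  ...   | V , (openV , open∁V) , _ , p∈V , q∉V =
    V , ∁ V , openV , open∁V , p∈V , q∉V , λ t∈V t∉V → t∉V t∈V
  hausdorff {p} {q} p≢q | yes _ | no q≰p with separation q p q≰p
  ...   | V , (openV , open∁V) , _ , q∈V , p∉V =
    ∁ V , V , open∁V , openV , p∉V , q∈V , λ t∉V → t∉V

  module _ {z : ℕ → Carrier X₀} {x : Carrier X₀} (z→x : Converges 𝒯 z x) where

    -- The complement of the separating upset is a neighbourhood of `x` with no point above `p`.
    eventually-≰ʳ : ∀ {p} → ¬ p ≤ x → Eventually (λ n → ¬ p ≤ z n)
    eventually-≰ʳ {p} p≰x with separation p x p≰x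
    ... | V , (_ , open∁V) , (up , _) , p∈V , x∉V with z→x (∁ V) open∁V x∉V
    ... | N , h = N , λ n N≤n p≤z → h n N≤n (up (p , p∈V , p≤z))

    eventually-≰ˡ : ∀ {q} → ¬ x ≤ q → Eventually (λ n → ¬ z n ≤ q)
    eventually-≰ˡ {q} x≰q with separation x q x≰q
    ... | V , (openV , _) , (up , _) , x∈V , q∉V with z→x V openV x∈V
    ... | N , h = N , λ n N≤n z≤q → q∉V (up (z _ , h n N≤n , z≤q))

    converges-∘ : ∀ {s} → StrictlyIncreasing s → Converges 𝒯 (z ∘ s) x
    converges-∘ s↑ W openW x∈W with z→x W openW x∈W
    ... | N , h = N , λ n N≤n → h _ (ℕₚ.≤-trans N≤n (i≤s[i] s↑ n))

  -- From an escaping sequence to a copy of some Z_i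

  module _ {x y : Carrier X₀} {U : Pred (Carrier X₀) ℓ}
    (openU : Open 𝒯 U) (y∈U : y ∈ U) (x≤y : x ≤ y) (y≰x : ¬ y ≤ x) where

    -- With `x ≤ y` and `y ≰ x`, these fields leave open only whether `x ≤ z n`, and whether
    -- `z m ≤ z n` for `n < m`.
    record Escaping (z : ℕ → Carrier X₀) : Set (suc ℓ) where
      field
        converges : Converges 𝒯 z x
        z∉↓U      : ∀ n → z n ∉ ↓ U
        y≰z       : ∀ n → ¬ y ≤ z n
        z≰z       : ∀ {m n} → m ℕ.< n → ¬ z m ≤ z n

    open Escaping

    escaping-∘ : ∀ {z s} → Escaping z → StrictlyIncreasing s → Escaping (z ∘ s)
    escaping-∘ esc s↑ = record
      { converges = converges-∘ (converges esc) s↑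
      ; z∉↓U      = λ n → z∉↓U esc _
      ; y≰z       = λ n → y≰z esc _
      ; z≰z       = λ m<n → z≰z esc (s↑ m<n)
      }

    z≰x : ∀ {z} → Escaping z → ∀ n → ¬ z n ≤ x
    z≰x esc n z≤x = z∉↓U esc n (y , y∈U , ≤-trans z≤x x≤y)

    -- The four order hypotheses say that the relations left open agree with the order of Z_{i+1}.
    module _ (i : Fin 3) {z : ℕ → Carrier X₀} (esc : Escaping z)
      (x<z⇒x≤z : ∀ {n} → Zlt i 𝕩 (𝕫 n) → x ≤ z n)
      (x≤z⇒x<z : ∀ {n} → x ≤ z n → Zlt i 𝕩 (𝕫 n))
      (z<z⇒z≤z : ∀ {m n} → Zlt i (𝕫 m) (𝕫 n) → z m ≤ z n)
      (z≤z⇒z<z : ∀ {m n} → n ℕ.< m → z m ≤ z n → Zlt i (𝕫 m) (𝕫 n)) where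

      private
        e : ZPoint → Carrier X₀
        e 𝕩     = x
        e 𝕪     = y
        e (𝕫 n) = z n

        _≤Z_ = OrderedSpace._≤_ (Z {ℓ} i)

        e-mono : ∀ {p q} → p ≤Z q → e p ≤ e q
        e-mono (inj₂ refl) = ≤-refl
        e-mono (inj₁ p<q) with Zlt-cases i p<q
        ... | inj₁ refl                  = x≤y
        ... | inj₂ (inj₁ (_ , refl))     = x<z⇒x≤z p<q
        ... | inj₂ (inj₂ (_ , _ , refl)) = z<z⇒z≤z p<q

        e-cancel : ∀ {p q} → e p ≤ e q → p ≤Z q
        e-cancel {𝕩}   {𝕩}   _   = inj₂ refl
        e-cancel {𝕩}   {𝕪}   _   = inj₁ (Zlt-x<y i)
        e-cancel {𝕩}   {𝕫 n} x≤z = inj₁ (x≤z⇒x<z x≤z)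
        e-cancel {𝕪}   {𝕩}   y≤x = ⊥-elim (y≰x y≤x)
        e-cancel {𝕪}   {𝕪}   _   = inj₂ refl
        e-cancel {𝕪}   {𝕫 n} y≤z = ⊥-elim (y≰z esc n y≤z)
        e-cancel {𝕫 m} {𝕩}   z≤x = ⊥-elim (z≰x esc m z≤x)
        e-cancel {𝕫 m} {𝕪}   z≤y = ⊥-elim (z∉↓U esc m (y , y∈U , z≤y))
        e-cancel {𝕫 m} {𝕫 n} z≤z with ℕₚ.<-cmp m n
        ... | tri< m<n _ _  = ⊥-elim (z≰z esc m<n z≤z)
        ... | tri≈ _ refl _ = inj₂ refl
        ... | tri> _ _ n<m  = inj₁ (z≤z⇒z<z n<m z≤z)

        -- A map that reflects the order is injective by antisymmetry, so the terms need not be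
        -- shown distinct separately.
        e-injective : Injective _≡_ _≡_ e
        e-injective ep≡eq = IsPartialOrder.antisym (OrderedSpace.isPartialOrder (Z {ℓ} i))
          (e-cancel (reflexive ep≡eq)) (e-cancel (reflexive (sym ep≡eq)))

        e-continuous : ∀ {V} → Open 𝒯 V → Open (topology (Z {ℓ} i)) (e ⊢ V)
        e-continuous {V} openV x∈V with converges esc V openV x∈V
        -- The exceptions are the terms before `N`, and `y′` whether or not `y` lies in `V`.
        ... | N , h = y′ ∷ map z′ (upTo N) , split
          where
          split : ∀ d → just d ∈ (e ⊢ V) ⊎ d ∈ˡ y′ ∷ map z′ (upTo N)
          split y′ = inj₂ (here refl)
          split (z′ n) with ℕₚ.<-≤-connex n N
          ... | inj₁ n<N = inj₂ (there (∈-map⁺ z′ (∈-upTo⁺ n<N)))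
          ... | inj₂ N≤n = inj₁ (h n N≤n)

      escaping⇒forbidden : IsForbiddenConfiguration i X
      escaping⇒forbidden =
        e ,
        onePoint-embedding 𝒯 em hausdorff e-injective e-continuous ,
        record
          { isOrderHomomorphism = record { cong = cong e ; mono = e-mono }
          ; injective = e-injective
          ; cancel    = e-cancel
          } ,
        U , openU , y∈U ,
        (λ { {𝕩}   _    → inj₁ refl
           ; {𝕪}   _    → inj₂ refl
           ; {𝕫 n} z∈↓U → ⊥-elim (z∉↓U esc n z∈↓U) }) ,
        λ { (inj₁ refl) → y , y∈U , x≤y
          ; (inj₂ refl) → y , y∈U , ≤-refl }

    decreasing⇒forbidden : ∀ {z} → Escaping z → (∀ {m n} → n ℕ.< m → z m ≤ z n) →
      IsForbiddenConfiguration Fin.zero X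
    decreasing⇒forbidden {z} esc dec = escaping⇒forbidden Fin.zero esc
      (λ _ → x≤z) (λ _ → x<z) (λ { (z<z n<m) → dec n<m }) (λ n<m _ → z<z n<m)
      where
      x≤z : ∀ {n} → x ≤ z n
      -- If `x ≰ z n`, then all late terms fail to be below `z n`; the index chosen is late and also
      -- exceeds `n`, where `dec` says the opposite.
      x≤z {n} = em⇒dne em λ x≰z →
        let N , h = eventually-≰ˡ (converges esc) x≰z
        in h (N ℕ.⊔ ℕ.suc n) (ℕₚ.m≤m⊔n N _) (dec (ℕₚ.m≤n⊔m N (ℕ.suc n)))

    -- As in the proof that every real sequence has a monotone subsequence:
    -- either there are infinitely many peaks, which form an antichain, or from
    -- some point on every term lies above a later one.
    escaping⇒∃forbidden : ∀ {z} → Escaping z → ∃[ i ] IsForbiddenConfiguration i X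
    escaping⇒∃forbidden {z} esc = split em em
      where
      Peak : Pred ℕ ℓ
      Peak n = ∀ {m} → n ℕ.< m → ¬ z m ≤ z n

      PeakAbove PeakBeside : Pred ℕ ℓ
      PeakAbove  n = Peak n × x ≤ z n
      PeakBeside n = Peak n × ¬ x ≤ z n

      anyEventually : ∀ n → Eventually (λ _ → n ≡ n)
      anyEventually n = 0 , λ _ _ → refl

      split : Dec (Frequently PeakAbove) → Dec (Frequently PeakBeside) →
        ∃[ i ] IsForbiddenConfiguration i X
      split (yes freq) _ with extract freq anyEventually
      ... | s , P , s↑ = Fin.suc Fin.zero ,
        escaping⇒forbidden _ (escaping-∘ esc (proj₁ ∘ s↑))
          (λ {n} _ → proj₂ (P n)) (λ _ → x<z) (λ ())
          (λ {_} {n} n<m z≤z → ⊥-elim (proj₁ (P n) (proj₁ (s↑ n<m)) z≤z))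
      split (no _) (yes freq) with extract freq anyEventually
      ... | s , P , s↑ = Fin.suc (Fin.suc Fin.zero) ,
        escaping⇒forbidden _ (escaping-∘ esc (proj₁ ∘ s↑))
          (λ ()) (λ {n} x≤z → ⊥-elim (proj₂ (P n) x≤z)) (λ ())
          (λ {_} {n} n<m z≤z → ⊥-elim (proj₁ (P n) (proj₁ (s↑ n<m)) z≤z))
      -- A peak at or past `N` would be either above `x` or not, and both are excluded. So each such
      -- term has a later term below it, and `chain` yields a decreasing subsequence.
      split (no ¬above) (no ¬beside)
        with eventually-∩ (¬frequently⇒eventually em ¬above) (¬frequently⇒eventually em ¬beside)
      ... | N , noPeak with chain {A = ∃ (N ℕ.≤_)} {T = T} (λ {u v w} → T-trans {u} {v} {w}) lower-term (N , ℕₚ.≤-refl)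
        where
        T : Rel (∃ (N ℕ.≤_)) ℓ
        T (n , _) (m , _) = n ℕ.< m × z m ≤ z n

        T-trans : Transitive T
        T-trans (n<m , zm≤zn) (m<l , zl≤zm) = ℕₚ.<-trans n<m m<l , ≤-trans zl≤zm zm≤zn

        lower-term : ∀ u → ∃ (T u)
        lower-term (n , N≤n) with em⇒dne em {∃[ m ] n ℕ.< m × z m ≤ z n} (λ none →
          let peak : Peak n
              peak n<m z≤z = none (_ , n<m , z≤z)
          in proj₂ (noPeak n N≤n) (peak , λ x≤z → proj₁ (noPeak n N≤n) (peak , x≤z)))
        ... | m , n<m , z≤z = (m , ℕₚ.≤-trans N≤n (ℕₚ.<⇒≤ n<m)) , n<m , z≤z
      ... | s , T↑ = Fin.zero ,
        decreasing⇒forbidden (escaping-∘ esc (proj₁ ∘ T↑)) (proj₂ ∘ T↑)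

    sequence⇒escaping : ∀ {z} → Converges 𝒯 z x → (∀ n → z n ∉ ↓ U) → ∃ Escaping
    sequence⇒escaping {z} z→x z∉↓U
      -- The relation handed to `extract` is `z n ≰ z m`: it holds for all late `m` because
      -- `z n ≤ x` would put `z n` in `↓ U`.
      with extract (eventually⇒frequently (eventually-≰ʳ z→x y≰x))
             (λ n → eventually-≰ʳ z→x (λ z≤x → z∉↓U n (y , y∈U , ≤-trans z≤x x≤y)))
    ... | s , y≰z , s↑ = z ∘ s , record
      { converges = converges-∘ z→x (proj₁ ∘ s↑)
      ; z∉↓U      = z∉↓U ∘ s
      ; y≰z       = y≰z
      ; z≰z       = proj₂ ∘ s↑
      }

  -- The two implications

  forbidden⇒¬esakia : ∀ {i} → IsForbiddenConfiguration i X → ¬ IsEsakia X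
  forbidden⇒¬esakia (e , emb , _ , U , openU , _ , e⁻¹↓U⊆ , ⊆e⁻¹↓U) esakia
    with IsTopologicalEmbedding.continuous emb (esakia U openU) (⊆e⁻¹↓U (inj₁ refl))
  -- All the `z′ n` would have to occur in the finite list `L`, which injectivity of `z′` forbids.
  ... | L , h = finite (mk↣ {to = z′} λ { refl → refl }) L
    λ n → fromInj₂ (λ z∈↓U → ⊥-elim (z∉xy (e⁻¹↓U⊆ z∈↓U))) (h (z′ n))
    where
    z∉xy : ∀ {n} → ¬ 𝕫 n ∈ ｛ 𝕩 ｝ ∪ ｛ 𝕪 ｝
    z∉xy (inj₁ ())
    z∉xy (inj₂ ())

  sequence⇒forbidden : ∀ {U} → Open 𝒯 U → ∀ {x z} → x ∈ ↓ U →
    Converges 𝒯 z x → (∀ n → z n ∉ ↓ U) → ∃[ i ] IsForbiddenConfiguration i X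
  sequence⇒forbidden {U} openU {x} {z} (y , y∈U , x≤y) z→x z∉↓U =
    escaping⇒∃forbidden openU y∈U x≤y y≰x
      (proj₂ (sequence⇒escaping openU y∈U x≤y y≰x z→x z∉↓U))
    where
    y≰x : ¬ y ≤ x
    -- Otherwise `x` equals `y` and lies in `U`, so convergence puts a term into `U` and hence into
    -- `↓ U`.
    y≰x y≤x with z→x U openU (subst U (antisym y≤x x≤y) y∈U)
    ... | N , h = z∉↓U N (z N , h N ℕₚ.≤-refl , ≤-refl)

  ¬open↓⇒forbidden : Metrizable 𝒯 → ∀ {U} → Open 𝒯 U → ¬ Open 𝒯 (↓ U) →
    ∃[ i ] IsForbiddenConfiguration i X
  ¬open↓⇒forbidden metrizable {U} openU ¬open↓U =
    let _ , x∈↓U , _ , z→x , z∉↓U = ¬open⇒sequence 𝒯 em metrizable (↓ U) ¬open↓U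
    in sequence⇒forbidden openU x∈↓U z→x z∉↓U

theorem2p2 : ∀ {ℓ : Level} → ExcludedMiddle (suc ℓ) →
    (X : PriestleySpace ℓ) → Metrizable (topology (orderedSpace X)) →
    (¬ IsEsakia X) ⇔ (∃[ i ] IsForbiddenConfiguration i X)
theorem2p2 em X metrizable = mk⇔
  (λ ¬esakia →
    let U , openU , ¬open↓U = em⇒dne em {∃[ U ] Open 𝒯 U × ¬ Open 𝒯 (↓ U)} λ none →
          ¬esakia λ U openU → em⇒dne (lower-em em) λ ¬open↓U → none (U , openU , ¬open↓U)
    in ¬open↓⇒forbidden (lower-em em) X metrizable openU ¬open↓U)
  (λ (_ , forbidden) → forbidden⇒¬esakia (lower-em em) X forbidden)
  where
  𝒯 = topology (orderedSpace X)
  open OrderedSpace (orderedSpace X) using (↓)
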